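{- Let $(X,S)$ be an association scheme, and let $H$ and $T$ be closed subsets of $S$ such that $H \subseteq T$ and $T$ is strongly normal in $S$. Assume that the following conditions are satisfied: (i) $sH=sT$ for each $s \in S \setminus T$; (ii) $tH=\{t\}$ for each $t \in T \setminus H$. Then, for each $\iota \in \mathrm{Aut}(T)$ fixing each element of $H$, we have $\tilde{\iota} \in \mathrm{Aut}(S)$, where $\tilde\iota: S\to S$ is defined by $s^{\tilde{\iota}} = s$ if $s \in S \setminus T$ and $s^{\tilde{\iota}}= s^{\iota}$ if $s \in T$.
   Context: An association scheme $(X,S)$ consists of a non-empty finite set $X$ and a partition $S$ of $X\times X$ such that: (i) $1_X:=\{(x,x)\mid x\in X\}\in S$; (ii) for each $s\in S$, $s^*:=\{(x,y)\mid (y,x)\in s\}\in S$; (iii) for all $s,t,u\in S$ the number $c_{st}^u:=|xs\cap yt^*|$ is constant whenever $(x,y)\in u$, where $xs:=\{y\in X\mid (x,y)\in s\}$. The $c_{st}^u$ are the intersection numbers. For non-empty $P,Q\subseteq S$, the complex product $PQ$ is the set of all $s\in S$ such that $c_{pq}^s\neq 0$ for some $p\in P$, $q\in Q$; a singleton $\{s\}$ in a complex product is written $s$. A non-empty subset $T\subseteq S$ is closed if $TT\subseteq T$. A closed subset $T$ is strongly normal in $S$ if $s^*Ts\subseteq T$ for every $s\in S$. For a closed subset $T$ of $S$ (including $T=S$), $\mathrm{Aut}(T)=\{\iota\in\mathrm{Sym}(T)\mid c_{rs}^t=c_{r^\iota s^\iota}^{t^\iota}\text{ for all }r,s,t\in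 T\}$. -}

module Defs where

open import Data.Fin.Base using (Fin)
open import Data.Fin.Properties using (any?)
open import Data.Fin.Subset
  using (Subset; _∈_; _∉_; _⊆_; _∩_; ⁅_⁆; ∣_∣; Nonempty) renaming (⊤ to full)
open import Data.Fin.Subset.Properties using (_∈?_; ∈⊤)
open import Data.Nat.Base using (ℕ; NonZero)
open import Data.Nat.Properties using (_≟_)
open import Data.Product using (∃; ∃₂; ∃!; _×_; _,_; proj₁)
open import Data.Vec.Base using (tabulate)
open import Function.Base using (_∘_; flip)
open import Function.Definitions using (Bijective)
open import Level using (0ℓ)
open import Relation.Binary.Core using (Rel; _⇔_)
import Relation.Binary.Definitions as Binary
open import Relation.Binary.PropositionalEquality.Core using (_≡_; _≢_)
open import Relation.Nullary.Decidable.Core using (does; yes; no; _×-dec_; ¬?)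
open import Relation.Unary using (Pred; Decidable)

-- { x ∣ P x }
setOf : ∀ {m} {P : Pred (Fin m) 0ℓ} → Decidable P → Subset m
setOf P? = tabulate (does ∘ P?)

-- The finite set X is Fin n, and the cells of the partition S of X × X are
-- indexed by Fin d: the index s stands for the relation R s.  Since the cells
-- are non-empty and every pair lies in exactly one of them, different indices
-- name different relations, so that Fin d is in bijection with S.
-- For the same reason 1X, _* and c are uniquely determined by the
-- laws imposed on them.
record AssociationScheme (n d : ℕ) : Set₁ where
  infix 8 _*
  field
    X-nonEmpty : NonZero n

    R         : Fin d → Rel (Fin n) 0ℓ
    R?        : ∀ s → Binary.Decidable (R s)
    nonEmpty  : ∀ s → ∃₂ (R s)
    partition : ∀ x y → ∃! _≡_ (λ s → R s x y)

    1X        : Fin d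
    1X-law    : R 1X ⇔ _≡_

    _*        : Fin d → Fin d
    *-law     : ∀ s → R (s *) ⇔ flip (R s)

  -- the set written xs in the literature
  neighbours : Fin n → Fin d → Subset n
  neighbours x s = setOf (R? s x)

  field
    -- c s t u is the intersection number c_{st}^u
    c         : Fin d → Fin d → Fin d → ℕ
    c-law     : ∀ s t u {x y} → R u x y →
                ∣ neighbours x s ∩ neighbours y (t *) ∣ ≡ c s t u

module _ {n d : ℕ} (𝒮 : AssociationScheme n d) where
  open AssociationScheme 𝒮

  complexProduct : Subset d → Subset d → Subset d
  complexProduct P Q = setOf {P = InProduct} inProduct?
    where
    InProduct : Pred (Fin d) 0ℓ
    InProduct s = ∃ λ p → p ∈ P × ∃ λ q → q ∈ Q × c p q s ≢ 0

    inProduct? : Decidable InProduct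
    inProduct? s =
      any? λ p → (p ∈? P) ×-dec any? λ q → (q ∈? Q) ×-dec ¬? (c p q s ≟ 0)

  Closed : Subset d → Set
  Closed T = Nonempty T × complexProduct T T ⊆ T

  StronglyNormal : Subset d → Set
  StronglyNormal T =
    Closed T × (∀ s → complexProduct (complexProduct ⁅ s * ⁆ T) ⁅ s ⁆ ⊆ T)

-- A subset regarded as a type.  Proofs of s ∈ T are unique, so equality of
-- elements is equality of their first components.
El : ∀ {d} → Subset d → Set
El T = ∃ (_∈ T)

-- f ∈ Aut(T); Aut(S) is the instance T = full.
IsAut : ∀ {n d} → AssociationScheme n d → (T : Subset d) → (El T → El T) → Set
IsAut 𝒮 T f =
  Bijective _≡_ _≡_ f ×
  (∀ r s t → c (proj₁ r) (proj₁ s) (proj₁ t)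
           ≡ c (proj₁ (f r)) (proj₁ (f s)) (proj₁ (f t)))
  where open AssociationScheme 𝒮

-- The map ι̃ : S → S that is ι on T and the identity outside T.
extend : ∀ {d} (T : Subset d) → (El T → El T) → El (full {d}) → El (full {d})
extend T ι (s , _) with s ∈? T
... | yes s∈T = proj₁ (ι (s , s∈T)) , ∈⊤
... | no  _   = s , ∈⊤

{-# OPTIONS --safe #-}
module Submission where

-- If r, s, t do not all lie in T, then c_{rs}^t can change under ι̃ only when
-- exactly one of them lies in T, since T defines an equivalence relation on X.
-- Suppose s ∈ T ∖ H and r ∉ T.  By (ii), {z ∣ (z,y) ∈ s} is a union of
-- H-cosets; by (i), every H-coset of the T-coset of y meets xr in the same
-- number k of points.  Hence |H| c_{rs}^t = k |s*|, where |·| is the valency,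
-- and ι preserves valencies.  The case r ∈ T ∖ H follows by transposition, and
-- the case t ∈ T ∖ H from |t| c_{rs}^t = |r| c_{t s*}^r.

open import Defs
open import Data.Bool.Base using (true; false; if_then_else_)
open import Data.Fin.Base using (Fin; zero; suc)
open import Data.Fin.Properties using (_≟_; any?)
open import Data.Fin.Subset using (Subset; _∈_; _∉_; _⊆_; _∩_; ⁅_⁆; ∣_∣) renaming (⊤ to full)
open import Data.Fin.Subset.Properties using (_∈?_; ∈⊤; x∈⁅x⁆; x∈⁅y⁆⇒x≡y)
open import Data.Nat.Base using (ℕ; zero; suc; _+_; _*_; _≤_; z≤n; ≢-nonZero)
open import Data.Nat.Properties as ℕ using (+-*-semiring)
open import Data.Product.Base using (∃; ∃₂; _×_; _,_; proj₁; proj₂)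
open import Data.Vec.Properties using (lookup∘tabulate; lookup⇒[]=; []=⇒lookup)
open import Data.Vec.Properties.WithK using ([]=-irrelevant)
open import Function.Base using (_∘_)
open import Relation.Binary.PropositionalEquality
open import Relation.Binary.Structures using (IsEquivalence)
open import Relation.Nullary using (¬_; Dec; yes; no; does; contradiction)
open import Relation.Nullary.Decidable using (dec-true; _×-dec_; ¬?; decidable-stable)
open import Relation.Unary using (Pred; Decidable)
open import Algebra.Properties.Semiring.Sum +-*-semiring

open ≡-Reasoning

-- Indicators and finite sums of natural numbers.

𝟙 : ∀ {A : Set} → Dec A → ℕ
𝟙 a? = if does a? then 1 else 0

𝟙-cong : ∀ {A B : Set} (a? : Dec A) (b? : Dec B) → (A → B) → (B → A) → 𝟙 a? ≡ 𝟙 b?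
𝟙-cong (yes _) (yes _)  _ _ = refl
𝟙-cong (no _)  (no _)   _ _ = refl
𝟙-cong (yes a) (no ¬b)  f _ = contradiction (f a) ¬b
𝟙-cong (no ¬a) (yes b)  _ g = contradiction (g b) ¬a

𝟙-true : ∀ {A : Set} (a? : Dec A) → A → 𝟙 a? ≡ 1
𝟙-true (yes _) _ = refl
𝟙-true (no ¬a) a = contradiction a ¬a

𝟙≡1⇒ : ∀ {A : Set} (a? : Dec A) → 𝟙 a? ≡ 1 → A
𝟙≡1⇒ (yes a) _ = a

𝟙-mono : ∀ {A B : Set} (a? : Dec A) (b? : Dec B) → (A → B) → 𝟙 a? ≤ 𝟙 b?
𝟙-mono (yes a) b? f = ℕ.≤-reflexive (sym (𝟙-true b? (f a)))
𝟙-mono (no _)  b? f = z≤n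

-- Inside a sum whose terms carry the factor `𝟙 a?`, an equation that holds only under `A` may still
-- be used for rewriting.
𝟙-guard : ∀ {A : Set} (a? : Dec A) {m n} → (A → m ≡ n) → 𝟙 a? * m ≡ 𝟙 a? * n
𝟙-guard (yes a) m≡n = cong (1 *_) (m≡n a)
𝟙-guard (no _)  _   = refl

𝟙*𝟙≢0⇒× : ∀ {A B : Set} (a? : Dec A) (b? : Dec B) → 𝟙 a? * 𝟙 b? ≢ 0 → A × B
𝟙*𝟙≢0⇒× (yes a) (yes b) _  = a , b
𝟙*𝟙≢0⇒× (yes _) (no _)  ≢0 = contradiction refl ≢0
𝟙*𝟙≢0⇒× (no _)  _       ≢0 = contradiction refl ≢0

sum≡0⇒≡0 : ∀ {n} (f : Fin n → ℕ) → sum f ≡ 0 → ∀ i → f i ≡ 0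
sum≡0⇒≡0 f eq zero    = ℕ.m+n≡0⇒m≡0 (f zero) eq
sum≡0⇒≡0 f eq (suc i) = sum≡0⇒≡0 (f ∘ suc) (ℕ.m+n≡0⇒n≡0 (f zero) eq) i

sum≢0⇒∃≢0 : ∀ {n} (f : Fin n → ℕ) → sum f ≢ 0 → ∃ λ i → f i ≢ 0
sum≢0⇒∃≢0 {zero}  f ≢0 = contradiction refl ≢0
sum≢0⇒∃≢0 {suc n} f ≢0 with f zero ℕ.≟ 0
... | no  f₀≢0 = zero , f₀≢0
... | yes f₀≡0 with sum≢0⇒∃≢0 (f ∘ suc) (λ eq → ≢0 (cong₂ _+_ f₀≡0 eq))
...   | i , fᵢ≢0 = suc i , fᵢ≢0

sum-mono : ∀ {n} {f g : Fin n → ℕ} → (∀ i → f i ≤ g i) → sum f ≤ sum g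
sum-mono {zero}  f≤g = z≤n
sum-mono {suc n} f≤g = ℕ.+-mono-≤ (f≤g zero) (sum-mono (f≤g ∘ suc))

-- A strict inequality at one index cannot be made up for at the others. Applied to indicators, it
-- says that a finite set contained in another of the same size is equal to it.
≤∧sum≡⇒≗ : ∀ {n} {f g : Fin n → ℕ} → (∀ i → f i ≤ g i) → sum f ≡ sum g → f ≗ g
≤∧sum≡⇒≗ {suc n} {f} {g} f≤g eq = λ where
    zero    → f₀≡g₀
    (suc i) → ≤∧sum≡⇒≗ (f≤g ∘ suc)
                (ℕ.+-cancelˡ-≡ (f zero) _ _ (trans eq (cong (_+ sum (g ∘ suc)) (sym f₀≡g₀)))) i
  where
  f₀≡g₀ : f zero ≡ g zero
  f₀≡g₀ = ℕ.≤-antisym (f≤g zero)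
    (ℕ.+-cancelʳ-≤ (sum (g ∘ suc)) _ _
      (ℕ.≤-trans (ℕ.≤-reflexive (sym eq)) (ℕ.+-monoʳ-≤ (f zero) (sum-mono (f≤g ∘ suc)))))

sum-*-𝟙≟ : ∀ {n} (f : Fin n → ℕ) a → sum (λ p → f p * 𝟙 (p ≟ a)) ≡ f a
sum-*-𝟙≟ {suc n} f zero = begin
  f zero * 1 + sum (λ p → f (suc p) * 0)
    ≡⟨ cong₂ _+_ (ℕ.*-identityʳ (f zero))
                 (trans (sum-cong-≗ (λ p → ℕ.*-zeroʳ (f (suc p)))) (sum-replicate-zero n)) ⟩
  f zero + 0 ≡⟨ ℕ.+-identityʳ _ ⟩
  f zero     ∎
sum-*-𝟙≟ f (suc a) = cong₂ _+_ (ℕ.*-zeroʳ (f zero)) (sum-*-𝟙≟ (f ∘ suc) a)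

-- Subsets cut out by decidable predicates.

∣setOf∩setOf∣ : ∀ {n} {P Q : Pred (Fin n) _} (P? : Decidable P) (Q? : Decidable Q) →
                ∣ setOf P? ∩ setOf Q? ∣ ≡ sum (λ z → 𝟙 (P? z) * 𝟙 (Q? z))
∣setOf∩setOf∣ {zero}  P? Q? = refl
∣setOf∩setOf∣ {suc n} P? Q? with does (P? zero) | does (Q? zero)
... | true  | true  = cong suc (∣setOf∩setOf∣ (P? ∘ suc) (Q? ∘ suc))
... | true  | false = ∣setOf∩setOf∣ (P? ∘ suc) (Q? ∘ suc)
... | false | _     = ∣setOf∩setOf∣ (P? ∘ suc) (Q? ∘ suc)

∈-setOf⁺ : ∀ {n} {P : Pred (Fin n) _} (P? : Decidable P) {i} → P i → i ∈ setOf P?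
∈-setOf⁺ P? {i} p = lookup⇒[]= i _ (trans (lookup∘tabulate _ i) (dec-true (P? i) p))

∈-setOf⁻ : ∀ {n} {P : Pred (Fin n) _} (P? : Decidable P) {i} → i ∈ setOf P? → P i
∈-setOf⁻ P? {i} i∈ with P? i | trans (sym (lookup∘tabulate (does ∘ P?) i)) ([]=⇒lookup i∈)
... | yes p | _  = p
... | no _  | ()

El-≡ : ∀ {d} {T : Subset d} {a b : El T} → proj₁ a ≡ proj₁ b → a ≡ b
El-≡ {a = _ , p} {b = _ , q} refl = cong (_ ,_) ([]=-irrelevant p q)

-- The relation of a pair of points, and the adjacency algebra.

module Scheme {n d : ℕ} (𝒮 : AssociationScheme n d) where
  open AssociationScheme 𝒮 renaming (_* to infix 8 _⁎)

  rel : Fin n → Fin n → Fin d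
  rel x y = proj₁ (partition x y)

  R-rel : ∀ x y → R (rel x y) x y
  R-rel x y = proj₁ (proj₂ (partition x y))

  R⇒rel≡ : ∀ {x y s} → R s x y → rel x y ≡ s
  R⇒rel≡ {x} {y} = proj₂ (proj₂ (partition x y))

  -- Cells are non-empty, so a claim about an arbitrary index can be proved by matching it with
  -- `rel x y` and arguing with points.
  rel-surjective : ∀ s → ∃₂ λ x y → rel x y ≡ s
  rel-surjective s with x , y , xsy ← nonEmpty s = x , y , R⇒rel≡ xsy

  rel-refl : ∀ x → rel x x ≡ 1X
  rel-refl x = R⇒rel≡ (proj₂ 1X-law refl)

  rel-⁎ : ∀ x y → rel y x ≡ rel x y ⁎
  rel-⁎ x y = R⇒rel≡ (proj₂ (*-law (rel x y)) (R-rel x y))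

  ⁎-involutive : ∀ s → s ⁎ ⁎ ≡ s
  ⁎-involutive s with x , y , refl ← rel-surjective s = begin
    rel x y ⁎ ⁎ ≡⟨ cong _⁎ (rel-⁎ x y) ⟨
    rel y x ⁎   ≡⟨ rel-⁎ y x ⟨
    rel x y     ∎

  rel≡⁎⇒ : ∀ {x y s} → rel y x ≡ s ⁎ → rel x y ≡ s
  rel≡⁎⇒ {x} {y} eq = trans (rel-⁎ y x) (trans (cong _⁎ eq) (⁎-involutive _))

  δ : Fin d → Fin d → ℕ
  δ s t = 𝟙 (s ≟ t)

  χ : Subset d → Fin d → ℕ
  χ P s = 𝟙 (s ∈? P)

  δ-⁎ : ∀ s x y → δ s (rel x y) ≡ δ (s ⁎) (rel y x)
  δ-⁎ s x y = 𝟙-cong (s ≟ _) (s ⁎ ≟ _) (λ { refl → sym (rel-⁎ x y) }) (sym ∘ rel≡⁎⇒ ∘ sym)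

  -- The product of the matrices Σ_s f(s) A_s and Σ_s g(s) A_s, where A_s is
  -- the adjacency matrix of s.
  infixl 7 _⋆_
  _⋆_ : (f g : Fin d → ℕ) → Fin n → Fin n → ℕ
  (f ⋆ g) x y = ∑[ z < n ] (f (rel x z) * g (rel z y))

  -- The count in `c-law` asks for `rel y z ≡ s ⁎`, which by `δ-⁎` is `rel z y ≡ s`. Intersection
  -- numbers are thus the entries of A_r A_s.
  c≡⋆ : ∀ r s x y → c r s (rel x y) ≡ (δ r ⋆ δ s) x y
  c≡⋆ r s x y = begin
    c r s (rel x y)                                  ≡⟨ c-law r s (rel x y) (R-rel x y) ⟨
    ∣ neighbours x r ∩ neighbours y (s ⁎) ∣          ≡⟨ ∣setOf∩setOf∣ (R? r x) (R? (s ⁎) y) ⟩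
    ∑[ z < n ] (𝟙 (R? r x z) * 𝟙 (R? (s ⁎) y z))
      ≡⟨ sum-cong-≗ {n} (λ z → cong₂ _*_ (𝟙R r x z) (trans (𝟙R (s ⁎) y z) (sym (δ-⁎ s z y)))) ⟩
    (δ r ⋆ δ s) x y                                  ∎
    where
    𝟙R : ∀ s x y → 𝟙 (R? s x y) ≡ δ s (rel x y)
    𝟙R s x y = 𝟙-cong (R? s x y) (s ≟ _) (sym ∘ R⇒rel≡) (λ { refl → R-rel x y })

  -- Linearity in the left factor: `f` is the combination of the `δ p` with coefficients `f p`, and
  -- the two summations commute.
  ⋆-expandˡ : ∀ f g x y → (f ⋆ g) x y ≡ ∑[ p < d ] (f p * (δ p ⋆ g) x y)
  ⋆-expandˡ f g x y = begin
    ∑[ z < n ] (f (rel x z) * g (rel z y))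
      ≡⟨ sum-cong-≗ {n} (λ z → cong (_* g (rel z y)) (sum-*-𝟙≟ f (rel x z))) ⟨
    ∑[ z < n ] (∑[ p < d ] (f p * δ p (rel x z)) * g (rel z y))
      ≡⟨ sum-cong-≗ {n} (λ z → *-distribʳ-sum (g (rel z y)) (λ p → f p * δ p (rel x z))) ⟩
    ∑[ z < n ] ∑[ p < d ] (f p * δ p (rel x z) * g (rel z y))
      ≡⟨ ∑-comm (λ z p → f p * δ p (rel x z) * g (rel z y)) ⟩
    ∑[ p < d ] ∑[ z < n ] (f p * δ p (rel x z) * g (rel z y))
      ≡⟨ sum-cong-≗ {d} (λ p → sum-cong-≗ {n} (λ z → ℕ.*-assoc (f p) _ _)) ⟩
    ∑[ p < d ] ∑[ z < n ] (f p * (δ p (rel x z) * g (rel z y)))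
      ≡⟨ sum-cong-≗ {d} (λ p → *-distribˡ-sum (f p) (λ z → δ p (rel x z) * g (rel z y))) ⟨
    ∑[ p < d ] (f p * (δ p ⋆ g) x y) ∎

  ⋆-expandʳ : ∀ f g x y → (f ⋆ g) x y ≡ ∑[ q < d ] ((f ⋆ δ q) x y * g q)
  ⋆-expandʳ f g x y = begin
    ∑[ z < n ] (f (rel x z) * g (rel z y))
      ≡⟨ sum-cong-≗ {n} (λ z → cong (f (rel x z) *_) (expand z)) ⟩
    ∑[ z < n ] (f (rel x z) * ∑[ q < d ] (δ q (rel z y) * g q))
      ≡⟨ sum-cong-≗ {n} (λ z → *-distribˡ-sum (f (rel x z)) (λ q → δ q (rel z y) * g q)) ⟩
    ∑[ z < n ] ∑[ q < d ] (f (rel x z) * (δ q (rel z y) * g q))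
      ≡⟨ ∑-comm (λ z q → f (rel x z) * (δ q (rel z y) * g q)) ⟩
    ∑[ q < d ] ∑[ z < n ] (f (rel x z) * (δ q (rel z y) * g q))
      ≡⟨ sum-cong-≗ {d} (λ q → sum-cong-≗ {n} (λ z → ℕ.*-assoc (f (rel x z)) _ _)) ⟨
    ∑[ q < d ] ∑[ z < n ] (f (rel x z) * δ q (rel z y) * g q)
      ≡⟨ sum-cong-≗ {d} (λ q → *-distribʳ-sum (g q) (λ z → f (rel x z) * δ q (rel z y))) ⟨
    ∑[ q < d ] ((f ⋆ δ q) x y * g q) ∎
    where
    expand : ∀ z → g (rel z y) ≡ ∑[ q < d ] (δ q (rel z y) * g q)
    expand z = trans (sym (sum-*-𝟙≟ g (rel z y)))
                     (sum-cong-≗ {d} (λ q → ℕ.*-comm (g q) (δ q (rel z y))))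

  -- The span of the A_s is closed under multiplication. By bilinearity only products of `δ p` and
  -- `δ q` matter, and their entries are intersection numbers.
  ⋆-cong-rel : ∀ f g {x y x′ y′} → rel x y ≡ rel x′ y′ → (f ⋆ g) x y ≡ (f ⋆ g) x′ y′
  ⋆-cong-rel f g {x} {y} {x′} {y′} eq = begin
    (f ⋆ g) x y                              ≡⟨ ⋆-expandˡ f g x y ⟩
    ∑[ p < d ] (f p * (δ p ⋆ g) x y)         ≡⟨ sum-cong-≗ {d} (λ p → cong (f p *_) (δ⋆-cong p)) ⟩
    ∑[ p < d ] (f p * (δ p ⋆ g) x′ y′)       ≡⟨ ⋆-expandˡ f g x′ y′ ⟨
    (f ⋆ g) x′ y′                            ∎
    where
    δ⋆δ-cong : ∀ p q → (δ p ⋆ δ q) x y ≡ (δ p ⋆ δ q) x′ y′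
    δ⋆δ-cong p q = trans (sym (c≡⋆ p q x y)) (trans (cong (c p q) eq) (c≡⋆ p q x′ y′))

    δ⋆-cong : ∀ p → (δ p ⋆ g) x y ≡ (δ p ⋆ g) x′ y′
    δ⋆-cong p = begin
      (δ p ⋆ g) x y                            ≡⟨ ⋆-expandʳ (δ p) g x y ⟩
      ∑[ q < d ] ((δ p ⋆ δ q) x y * g q)       ≡⟨ sum-cong-≗ {d} (λ q → cong (_* g q) (δ⋆δ-cong p q)) ⟩
      ∑[ q < d ] ((δ p ⋆ δ q) x′ y′ * g q)     ≡⟨ ⋆-expandʳ (δ p) g x′ y′ ⟨
      (δ p ⋆ g) x′ y′                          ∎

  c≢0⇒∃ : ∀ {r s} x y → c r s (rel x y) ≢ 0 → ∃ λ z → r ≡ rel x z × s ≡ rel z y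
  c≢0⇒∃ {r} {s} x y c≢0 with sum≢0⇒∃≢0 {n} _ (c≢0 ∘ trans (c≡⋆ r s x y))
  ... | z , ≢0 = z , 𝟙*𝟙≢0⇒× (r ≟ _) (s ≟ _) ≢0

  -- The summand at `z` in the matrix product is 1.
  c-rel≢0 : ∀ x y z → c (rel x z) (rel z y) (rel x y) ≢ 0
  c-rel≢0 x y z eq = contradiction
    (trans (sym (sum≡0⇒≡0 {n} _ (trans (sym (c≡⋆ (rel x z) (rel z y) x y)) eq) z))
           (cong₂ _*_ (𝟙-true (rel x z ≟ rel x z) refl) (𝟙-true (rel z y ≟ rel z y) refl)))
    λ ()

  -- This and `inProduct?` restate the local definitions inside `complexProduct`, so that
  -- `complexProduct 𝒮 P Q` unfolds to `setOf (inProduct? P Q)`.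
  InProduct : (P Q : Subset d) → Pred (Fin d) _
  InProduct P Q s = ∃ λ p → p ∈ P × ∃ λ q → q ∈ Q × c p q s ≢ 0

  inProduct? : ∀ P Q → Decidable (InProduct P Q)
  inProduct? P Q s =
    any? λ p → (p ∈? P) ×-dec any? λ q → (q ∈? Q) ×-dec ¬? (c p q s ℕ.≟ 0)

  ∈-product⁺ : ∀ {P Q} x y z → rel x z ∈ P → rel z y ∈ Q → rel x y ∈ complexProduct 𝒮 P Q
  ∈-product⁺ {P} {Q} x y z ∈P ∈Q = ∈-setOf⁺ (inProduct? P Q) (_ , ∈P , _ , ∈Q , c-rel≢0 x y z)

  ∈-product⁻ : ∀ {P Q} x y → rel x y ∈ complexProduct 𝒮 P Q →
               ∃ λ z → rel x z ∈ P × rel z y ∈ Q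
  ∈-product⁻ {P} {Q} x y xy∈PQ with ∈-setOf⁻ (inProduct? P Q) xy∈PQ
  ... | p , p∈P , q , q∈Q , c≢0 with c≢0⇒∃ x y c≢0
  ...   | z , refl , refl = z , p∈P , q∈Q

  -- (A_r A_s)ᵀ = A_{s⁎} A_{r⁎}
  c-transpose : ∀ r s t → c r s t ≡ c (s ⁎) (r ⁎) (t ⁎)
  c-transpose r s t with x , y , refl ← rel-surjective t = begin
    c r s (rel x y)              ≡⟨ c≡⋆ r s x y ⟩
    (δ r ⋆ δ s) x y
      ≡⟨ sum-cong-≗ {n} (λ z → trans (cong₂ _*_ (δ-⁎ r x z) (δ-⁎ s z y)) (ℕ.*-comm (δ (r ⁎) (rel z x)) _)) ⟩
    (δ (s ⁎) ⋆ δ (r ⁎)) y x      ≡⟨ c≡⋆ (s ⁎) (r ⁎) y x ⟨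
    c (s ⁎) (r ⁎) (rel y x)      ≡⟨ cong (c (s ⁎) (r ⁎)) (rel-⁎ x y) ⟩
    c (s ⁎) (r ⁎) (rel x y ⁎)    ∎

  -- Valencies.

  valency : Fin d → ℕ
  valency s = c s (s ⁎) 1X

  -- A closed walk from `x` along `s` and back along `s ⁎` is determined by its midpoint, since the
  -- second step is the reverse of the first.
  out-degree : ∀ s x → ∑[ y < n ] δ s (rel x y) ≡ valency s
  out-degree s x = begin
    ∑[ y < n ] δ s (rel x y)
      ≡⟨ sum-cong-≗ {n} (λ y → trans (sym (ℕ.*-identityʳ _)) (𝟙-guard (s ≟ rel x y)
           λ { refl → sym (𝟙-true (_ ≟ _) (sym (rel-⁎ x y))) })) ⟩
    (δ s ⋆ δ (s ⁎)) x x     ≡⟨ c≡⋆ s (s ⁎) x x ⟨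
    c s (s ⁎) (rel x x)     ≡⟨ cong (c s (s ⁎)) (rel-refl x) ⟩
    valency s               ∎

  in-degree : ∀ s y → ∑[ x < n ] δ s (rel x y) ≡ valency (s ⁎)
  in-degree s y = trans (sum-cong-≗ {n} (λ x → δ-⁎ s x y)) (out-degree (s ⁎) y)

  valency≢0 : ∀ s → valency s ≢ 0
  valency≢0 s with x , y , refl ← rel-surjective s =
    subst₂ (λ a b → c (rel x y) a b ≢ 0) (rel-⁎ x y) (rel-refl x) (c-rel≢0 x x y)

  -- Count the triangles x, y, z with rel x y = t, rel x z = r, rel z y = s and
  -- x fixed.
  valency-*-c : ∀ r s t → valency t * c r s t ≡ valency r * c t (s ⁎) r
  valency-*-c r s t with x , _ ← rel-surjective t = begin
    valency t * c r s t
      ≡⟨ cong (_* c r s t) (out-degree t x) ⟨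
    ∑[ y < n ] δ t (rel x y) * c r s t
      ≡⟨ *-distribʳ-sum (c r s t) (λ y → δ t (rel x y)) ⟩
    ∑[ y < n ] (δ t (rel x y) * c r s t)
      ≡⟨ sum-cong-≗ {n} (λ y → 𝟙-guard (t ≟ rel x y) (λ { refl → c≡⋆ r s x y })) ⟩
    ∑[ y < n ] (δ t (rel x y) * (δ r ⋆ δ s) x y)
      ≡⟨ sum-cong-≗ {n} (λ y → *-distribˡ-sum (δ t (rel x y)) (λ z → δ r (rel x z) * δ s (rel z y))) ⟩
    ∑[ y < n ] ∑[ z < n ] (δ t (rel x y) * (δ r (rel x z) * δ s (rel z y)))
      ≡⟨ ∑-comm (λ y z → δ t (rel x y) * (δ r (rel x z) * δ s (rel z y))) ⟩
    ∑[ z < n ] ∑[ y < n ] (δ t (rel x y) * (δ r (rel x z) * δ s (rel z y)))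
      ≡⟨ sum-cong-≗ {n} (λ z → sum-cong-≗ {n} (λ y → rearrange z y)) ⟩
    ∑[ z < n ] ∑[ y < n ] (δ r (rel x z) * (δ t (rel x y) * δ (s ⁎) (rel y z)))
      ≡⟨ sum-cong-≗ {n} (λ z → *-distribˡ-sum (δ r (rel x z)) (λ y → δ t (rel x y) * δ (s ⁎) (rel y z))) ⟨
    ∑[ z < n ] (δ r (rel x z) * (δ t ⋆ δ (s ⁎)) x z)
      ≡⟨ sum-cong-≗ {n} (λ z → 𝟙-guard (r ≟ rel x z) (λ { refl → sym (c≡⋆ t (s ⁎) x z) })) ⟩
    ∑[ z < n ] (δ r (rel x z) * c t (s ⁎) r)
      ≡⟨ *-distribʳ-sum (c t (s ⁎) r) (λ z → δ r (rel x z)) ⟨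
    ∑[ z < n ] δ r (rel x z) * c t (s ⁎) r
      ≡⟨ cong (_* c t (s ⁎) r) (out-degree r x) ⟩
    valency r * c t (s ⁎) r ∎
    where
    swap-factors : ∀ a b c → a * (b * c) ≡ b * (a * c)
    swap-factors a b c = trans (sym (ℕ.*-assoc a b c))
                        (trans (cong (_* c) (ℕ.*-comm a b)) (ℕ.*-assoc b a c))

    rearrange : ∀ z y → δ t (rel x y) * (δ r (rel x z) * δ s (rel z y))
                      ≡ δ r (rel x z) * (δ t (rel x y) * δ (s ⁎) (rel y z))
    rearrange z y = trans (swap-factors (δ t (rel x y)) (δ r (rel x z)) _)
      (cong (λ k → δ r (rel x z) * (δ t (rel x y) * k)) (δ-⁎ s z y))

  -- Closed subsets as equivalence relations on points.

  module ClosedSubset {T : Subset d} (T-closed : Closed 𝒮 T) where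

    ∈-trans : ∀ {x y z} → rel x y ∈ T → rel y z ∈ T → rel x z ∈ T
    ∈-trans {x} {y} {z} xy yz = proj₂ T-closed (∈-product⁺ x z y xy yz)

    -- The size of xT is a diagonal entry of a product in the adjacency algebra, namely with the
    -- all-ones matrix, and all diagonal pairs lie in `1X`.
    coset-size : ∀ x y → ∑[ z < n ] χ T (rel x z) ≡ ∑[ z < n ] χ T (rel y z)
    coset-size x y = begin
      ∑[ z < n ] χ T (rel x z)     ≡⟨ sum-cong-≗ {n} (λ z → ℕ.*-identityʳ _) ⟨
      (χ T ⋆ (λ _ → 1)) x x        ≡⟨ ⋆-cong-rel (χ T) (λ _ → 1) (trans (rel-refl x) (sym (rel-refl y))) ⟩
      (χ T ⋆ (λ _ → 1)) y y        ≡⟨ sum-cong-≗ {n} (λ z → ℕ.*-identityʳ _) ⟩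
      ∑[ z < n ] χ T (rel y z)     ∎

    -- If (x,y) ∈ T then yT ⊆ xT, and both sets have the same finite size.
    ∈-euclidean : ∀ {x y z} → rel x y ∈ T → rel x z ∈ T → rel y z ∈ T
    ∈-euclidean {x} {y} {z} xy xz = 𝟙≡1⇒ (rel y z ∈? T) (begin
      χ T (rel y z) ≡⟨ ≤∧sum≡⇒≗ (λ w → 𝟙-mono (rel y w ∈? T) (rel x w ∈? T) (∈-trans xy))
                                (coset-size y x) z ⟩
      χ T (rel x z) ≡⟨ 𝟙-true (rel x z ∈? T) xz ⟩
      1             ∎)

    1X∈ : 1X ∈ T
    1X∈ with t , t∈T ← proj₁ T-closed with x , y , refl ← rel-surjective t =
      -- Any pair x, y related by T gives `rel y y ∈ T`.
      subst (_∈ T) (rel-refl y) (∈-euclidean t∈T t∈T)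

    ∈-isEquivalence : IsEquivalence (λ x y → rel x y ∈ T)
    ∈-isEquivalence = record
      { refl  = λ {x} → rel-xx x
      ; sym   = λ {x} xy → ∈-euclidean xy (rel-xx x)
      ; trans = ∈-trans
      }
      where
      rel-xx : ∀ x → rel x x ∈ T
      rel-xx x = subst (_∈ T) (sym (rel-refl x)) 1X∈

    open IsEquivalence ∈-isEquivalence public
      using () renaming (refl to ∈-refl; sym to ∈-sym)

    ⁎-∈ : ∀ {s} → s ∈ T → s ⁎ ∈ T
    ⁎-∈ {s} s∈T with x , y , refl ← rel-surjective s = subst (_∈ T) (rel-⁎ x y) (∈-sym s∈T)

    ⁎-∈⁻ : ∀ {s} → s ⁎ ∈ T → s ∈ T
    ⁎-∈⁻ {s} s⁎∈T = subst (_∈ T) (⁎-involutive s) (⁎-∈ s⁎∈T)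

    -- A non-zero intersection number yields a triangle of points, and two sides of a triangle in an
    -- equivalence relation force the third.
    c≢0⇒∈ : ∀ {r s t} → c r s t ≢ 0 →
            (r ∈ T → s ∈ T → t ∈ T) × (r ∈ T → t ∈ T → s ∈ T) × (s ∈ T → t ∈ T → r ∈ T)
    c≢0⇒∈ {t = t} c≢0 with x , y , refl ← rel-surjective t with z , refl , refl ← c≢0⇒∃ x y c≢0 =
      ∈-trans , ∈-euclidean , (λ zy xy → ∈-trans xy (∈-sym zy))

  -- Intersection numbers under conditions (i) and (ii).

  module Wreath {H T : Subset d} (H-closed : Closed 𝒮 H) (T-closed : Closed 𝒮 T) (H⊆T : H ⊆ T)
    (sH≡sT : ∀ s → s ∉ T → complexProduct 𝒮 ⁅ s ⁆ H ≡ complexProduct 𝒮 ⁅ s ⁆ T)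
    (tH≡t : ∀ t → t ∈ T → t ∉ H → complexProduct 𝒮 ⁅ t ⁆ H ≡ ⁅ t ⁆) where

    module H = ClosedSubset H-closed
    module T = ClosedSubset T-closed

    tH-absorb : ∀ {x y z} → rel x y ∈ T → rel x y ∉ H → rel y z ∈ H → rel x z ≡ rel x y
    tH-absorb {x} {y} {z} xy∈T xy∉H yz∈H = x∈⁅y⁆⇒x≡y _
      (subst (rel x z ∈_) (tH≡t _ xy∈T xy∉H) (∈-product⁺ x z y (x∈⁅x⁆ _) yz∈H))

    -- Condition (ii) concerns multiplication by H on the right; transposition carries it to the
    -- left.
    Ht-absorb : ∀ {x y z} → rel x y ∈ T → rel x y ∉ H → rel z x ∈ H → rel z y ≡ rel x y
    Ht-absorb {x} {y} {z} xy∈T xy∉H zx∈H = begin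
      rel z y   ≡⟨ rel-⁎ y z ⟩
      rel y z ⁎ ≡⟨ cong _⁎ (tH-absorb (T.∈-sym xy∈T) (xy∉H ∘ H.∈-sym) (H.∈-sym zx∈H)) ⟩
      rel y x ⁎ ≡⟨ rel-⁎ y x ⟨
      rel x y   ∎

    δ-H-invariant : ∀ {s w y z} → s ∈ T → s ∉ H → rel z w ∈ H → δ s (rel w y) ≡ δ s (rel z y)
    δ-H-invariant {s} {w} {y} {z} s∈T s∉H zw∈H = 𝟙-cong (s ≟ rel w y) (s ≟ rel z y)
      (λ { refl → sym (Ht-absorb s∈T s∉H zw∈H) })
      (λ { refl → sym (Ht-absorb s∈T s∉H (H.∈-sym zw∈H)) })

    -- The number of points of xr in the H-coset of w.
    coset-fibre : Fin d → Fin n → Fin n → ℕ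
    coset-fibre r x w = (δ r ⋆ χ H) x w

    coset-fibre-H-invariant : ∀ r x {w w′} → rel w w′ ∈ H → coset-fibre r x w ≡ coset-fibre r x w′
    coset-fibre-H-invariant r x ww′∈H = sum-cong-≗ {n} (λ z → cong (δ r (rel x z) *_)
      (𝟙-cong (_ ∈? H) (_ ∈? H) (λ zw → H.∈-trans zw ww′∈H) (λ zw′ → H.∈-trans zw′ (H.∈-sym ww′∈H))))

    -- By (i), rH is rT, and rT is stable under a further step in T.
    rH-T-invariant : ∀ {r x w y} → r ∉ T → rel w y ∈ T →
                     rel x w ∈ complexProduct 𝒮 ⁅ r ⁆ H → rel x y ∈ complexProduct 𝒮 ⁅ r ⁆ H
    rH-T-invariant {r} {x} {w} {y} r∉T wy∈T xw∈rH =
      let z , xz∈r , zw∈H = ∈-product⁻ x w xw∈rH in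
      subst (rel x y ∈_) (sym (sH≡sT r r∉T)) (∈-product⁺ x y z xz∈r (T.∈-trans (H⊆T zw∈H) wy∈T))

    coset-fibre-∉ : ∀ {r x w} → rel x w ∉ complexProduct 𝒮 ⁅ r ⁆ H → coset-fibre r x w ≡ 0
    coset-fibre-∉ {r} {x} {w} xw∉rH = decidable-stable (coset-fibre r x w ℕ.≟ 0) λ ≢0 →
      let z , ≢0′ = sum≢0⇒∃≢0 {n} _ ≢0
          r≡xz , zw∈H = 𝟙*𝟙≢0⇒× (r ≟ rel x z) (rel z w ∈? H) ≢0′
      in xw∉rH (∈-product⁺ x w z (subst (_∈ ⁅ r ⁆) r≡xz (x∈⁅x⁆ r)) zw∈H)

    -- Inside their H-cosets, `w` and `y` can be replaced by points of xr. Both are then in relation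
    -- `r` to `x`, and the fibre depends only on that relation.
    coset-fibre-∈ : ∀ {r x w y} → rel x w ∈ complexProduct 𝒮 ⁅ r ⁆ H →
                    rel x y ∈ complexProduct 𝒮 ⁅ r ⁆ H → coset-fibre r x w ≡ coset-fibre r x y
    coset-fibre-∈ {r} {x} {w} {y} xw∈rH xy∈rH =
      let z , xz∈r , zw∈H = ∈-product⁻ x w xw∈rH
          z′ , xz′∈r , z′y∈H = ∈-product⁻ x y xy∈rH
      in begin
      coset-fibre r x w    ≡⟨ coset-fibre-H-invariant r x zw∈H ⟨
      coset-fibre r x z    ≡⟨ ⋆-cong-rel (δ r) (χ H) (trans (x∈⁅y⁆⇒x≡y r xz∈r)
                                                            (sym (x∈⁅y⁆⇒x≡y r xz′∈r))) ⟩
      coset-fibre r x z′   ≡⟨ coset-fibre-H-invariant r x z′y∈H ⟩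
      coset-fibre r x y    ∎

    -- A T-coset lies either inside or outside the set of points related to `x` by rH. Fibres agree
    -- by `coset-fibre-∈` in the first case and are empty in the second.
    coset-fibre-T-invariant : ∀ {r} x {w y} → r ∉ T → rel w y ∈ T →
                              coset-fibre r x w ≡ coset-fibre r x y
    coset-fibre-T-invariant {r} x {w} {y} r∉T wy∈T = by-cases (rel x w ∈? complexProduct 𝒮 ⁅ r ⁆ H)
      where
      by-cases : Dec (rel x w ∈ complexProduct 𝒮 ⁅ r ⁆ H) → coset-fibre r x w ≡ coset-fibre r x y
      by-cases (yes xw∈rH) = coset-fibre-∈ xw∈rH (rH-T-invariant r∉T wy∈T xw∈rH)
      by-cases (no xw∉rH)  = trans (coset-fibre-∉ xw∉rH)
        (sym (coset-fibre-∉ (xw∉rH ∘ rH-T-invariant r∉T (T.∈-sym wy∈T))))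

    -- Double counting of pairs z, w with `rel x z ≡ r`, `rel z w ∈ H` and `rel w y ≡ s`. A point z
    -- of xr admits |H| choices of w if `rel z y ≡ s`, and none otherwise. A point w with
    -- `rel w y ≡ s` lies in the T-coset of `y`, so it admits `coset-fibre r x y` choices of z.
    c-*-∣H∣ : ∀ {r s} x y → r ∉ T → s ∈ T → s ∉ H →
              c r s (rel x y) * ∑[ w < n ] χ H (rel x w) ≡ coset-fibre r x y * valency (s ⁎)
    c-*-∣H∣ {r} {s} x y r∉T s∈T s∉H = begin
      c r s (rel x y) * ∣H∣
        ≡⟨ cong (_* ∣H∣) (c≡⋆ r s x y) ⟩
      (δ r ⋆ δ s) x y * ∣H∣
        ≡⟨ *-distribʳ-sum ∣H∣ (λ z → δ r (rel x z) * δ s (rel z y)) ⟩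
      ∑[ z < n ] (δ r (rel x z) * δ s (rel z y) * ∣H∣)
        ≡⟨ sum-cong-≗ {n} (λ z → trans (ℕ.*-assoc (δ r (rel x z)) _ _)
                                    (cong (δ r (rel x z) *_) (absorb z))) ⟩
      ∑[ z < n ] (δ r (rel x z) * (χ H ⋆ δ s) z y)
        ≡⟨ sum-cong-≗ {n} (λ z → *-distribˡ-sum (δ r (rel x z)) (λ w → χ H (rel z w) * δ s (rel w y))) ⟩
      ∑[ z < n ] ∑[ w < n ] (δ r (rel x z) * (χ H (rel z w) * δ s (rel w y)))
        ≡⟨ ∑-comm (λ z w → δ r (rel x z) * (χ H (rel z w) * δ s (rel w y))) ⟩
      ∑[ w < n ] ∑[ z < n ] (δ r (rel x z) * (χ H (rel z w) * δ s (rel w y)))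
        ≡⟨ sum-cong-≗ {n} (λ w → sum-cong-≗ {n} (λ z → ℕ.*-assoc (δ r (rel x z)) _ _)) ⟨
      ∑[ w < n ] ∑[ z < n ] (δ r (rel x z) * χ H (rel z w) * δ s (rel w y))
        ≡⟨ sum-cong-≗ {n} (λ w → *-distribʳ-sum (δ s (rel w y)) (λ z → δ r (rel x z) * χ H (rel z w))) ⟨
      ∑[ w < n ] (coset-fibre r x w * δ s (rel w y))
        ≡⟨ sum-cong-≗ {n} constant-fibre ⟩
      ∑[ w < n ] (coset-fibre r x y * δ s (rel w y))
        ≡⟨ *-distribˡ-sum (coset-fibre r x y) (λ w → δ s (rel w y)) ⟨
      coset-fibre r x y * ∑[ w < n ] δ s (rel w y)
        ≡⟨ cong (coset-fibre r x y *_) (in-degree s y) ⟩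
      coset-fibre r x y * valency (s ⁎) ∎
      where
      ∣H∣ : ℕ
      ∣H∣ = ∑[ w < n ] χ H (rel x w)

      absorb : ∀ z → δ s (rel z y) * ∣H∣ ≡ (χ H ⋆ δ s) z y
      absorb z = begin
        δ s (rel z y) * ∣H∣
          ≡⟨ cong (δ s (rel z y) *_) (H.coset-size x z) ⟩
        δ s (rel z y) * ∑[ w < n ] χ H (rel z w)
          ≡⟨ ℕ.*-comm (δ s (rel z y)) _ ⟩
        ∑[ w < n ] χ H (rel z w) * δ s (rel z y)
          ≡⟨ *-distribʳ-sum (δ s (rel z y)) (λ w → χ H (rel z w)) ⟩
        ∑[ w < n ] (χ H (rel z w) * δ s (rel z y))
          ≡⟨ sum-cong-≗ {n} (λ w → 𝟙-guard (rel z w ∈? H) (sym ∘ δ-H-invariant s∈T s∉H)) ⟩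
        (χ H ⋆ δ s) z y ∎

      constant-fibre : ∀ w → coset-fibre r x w * δ s (rel w y) ≡ coset-fibre r x y * δ s (rel w y)
      constant-fibre w = begin
        coset-fibre r x w * δ s (rel w y) ≡⟨ ℕ.*-comm _ (δ s (rel w y)) ⟩
        δ s (rel w y) * coset-fibre r x w
          ≡⟨ 𝟙-guard (s ≟ rel w y) (λ { refl → coset-fibre-T-invariant x r∉T s∈T }) ⟩
        δ s (rel w y) * coset-fibre r x y ≡⟨ ℕ.*-comm (δ s (rel w y)) _ ⟩
        coset-fibre r x y * δ s (rel w y) ∎

    -- The right side of `c-*-∣H∣` involves `s` only through the valency of `s ⁎`, and |H| can be
    -- cancelled.
    c-congʳ : ∀ {r s s′} t → r ∉ T → s ∈ T → s ∉ H → s′ ∈ T → s′ ∉ H →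
              valency (s ⁎) ≡ valency (s′ ⁎) → c r s t ≡ c r s′ t
    c-congʳ {r} {s} {s′} t r∉T s∈T s∉H s′∈T s′∉H eq with x , y , refl ← rel-surjective t =
      ℕ.*-cancelʳ-≡ _ _ _ ⦃ ≢-nonZero (∣H∣≢0 x) ⦄ (begin
        c r s (rel x y) * ∑[ w < n ] χ H (rel x w)   ≡⟨ c-*-∣H∣ x y r∉T s∈T s∉H ⟩
        coset-fibre r x y * valency (s ⁎)            ≡⟨ cong (coset-fibre r x y *_) eq ⟩
        coset-fibre r x y * valency (s′ ⁎)           ≡⟨ c-*-∣H∣ x y r∉T s′∈T s′∉H ⟨
        c r s′ (rel x y) * ∑[ w < n ] χ H (rel x w)  ∎)
      where
      ∣H∣≢0 : ∀ x → ∑[ w < n ] χ H (rel x w) ≢ 0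
      ∣H∣≢0 x ≡0 = contradiction
        (trans (sym (sum≡0⇒≡0 {n} _ ≡0 x)) (𝟙-true (rel x x ∈? H) H.∈-refl)) λ ()

    -- Transposition turns the left index into the right one. The valency then required is that of
    -- `r ⁎ ⁎`, which is `r`.
    c-congˡ : ∀ {r r′ s} t → s ∉ T → r ∈ T → r ∉ H → r′ ∈ T → r′ ∉ H →
              valency r ≡ valency r′ → c r s t ≡ c r′ s t
    c-congˡ {r} {r′} {s} t s∉T r∈T r∉H r′∈T r′∉H eq = begin
      c r s t                 ≡⟨ c-transpose r s t ⟩
      c (s ⁎) (r ⁎) (t ⁎)
        ≡⟨ c-congʳ (t ⁎) (s∉T ∘ T.⁎-∈⁻) (T.⁎-∈ r∈T) (r∉H ∘ H.⁎-∈⁻) (T.⁎-∈ r′∈T) (r′∉H ∘ H.⁎-∈⁻)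
             (subst₂ (λ a b → valency a ≡ valency b)
                     (sym (⁎-involutive r)) (sym (⁎-involutive r′)) eq) ⟩
      c (s ⁎) (r′ ⁎) (t ⁎)    ≡⟨ c-transpose r′ s t ⟨
      c r′ s t                ∎

    -- Triangle counting moves the upper index to the left lower position, where `c-congˡ` applies;
    -- `r` may lie inside or outside T.
    c-congᵘ : ∀ {r s t t′} → s ∉ T → t ∈ T → t ∉ H → t′ ∈ T → t′ ∉ H →
              valency t ≡ valency t′ → c r s t ≡ c r s t′
    c-congᵘ {r} {s} {t} {t′} s∉T t∈T t∉H t′∈T t′∉H eq =
      ℕ.*-cancelˡ-≡ _ _ (valency t) ⦃ ≢-nonZero (valency≢0 t) ⦄ (begin
        valency t * c r s t          ≡⟨ valency-*-c r s t ⟩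
        valency r * c t (s ⁎) r
          ≡⟨ cong (valency r *_) (c-congˡ r (s∉T ∘ T.⁎-∈⁻) t∈T t∉H t′∈T t′∉H eq) ⟩
        valency r * c t′ (s ⁎) r     ≡⟨ valency-*-c r s t′ ⟨
        valency t′ * c r s t′        ≡⟨ cong (_* c r s t′) eq ⟨
        valency t * c r s t′         ∎)

    -- The extended map and its automorphism property.

    module Extension (ι : El T → El T) (ι-aut : IsAut 𝒮 T ι)
                     (ι-fixes-H : ∀ h → proj₁ h ∈ H → ι h ≡ h) where

      ι-injective : ∀ {a b} → ι a ≡ ι b → a ≡ b
      ι-injective = proj₁ (proj₁ ι-aut)

      ι-c : ∀ r s t → c (proj₁ r) (proj₁ s) (proj₁ t)
                    ≡ c (proj₁ (ι r)) (proj₁ (ι s)) (proj₁ (ι t))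
      ι-c = proj₂ ι-aut

      ι-1X : proj₁ (ι (1X , T.1X∈)) ≡ 1X
      ι-1X = cong proj₁ (ι-fixes-H _ H.1X∈)

      -- s⁎ is the only u with c_{su}^1 ≠ 0.
      ι-⁎ : ∀ a → proj₁ (ι (proj₁ a ⁎ , T.⁎-∈ (proj₂ a))) ≡ proj₁ (ι a) ⁎
      ι-⁎ a@(s , s∈T)
        with x , _ ← rel-surjective 1X
        with z , eq , eq′ ← c≢0⇒∃ x x (λ ≡0 → valency≢0 s (trans
               (ι-c a (s ⁎ , T.⁎-∈ s∈T) (1X , T.1X∈))
               (trans (cong (c _ _) (trans ι-1X (sym (rel-refl x)))) ≡0))) =
        trans eq′ (trans (rel-⁎ x z) (cong _⁎ (sym eq)))

      ι-valency : ∀ a → valency (proj₁ a) ≡ valency (proj₁ (ι a))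
      ι-valency a@(s , s∈T) = begin
        c s (s ⁎) 1X       ≡⟨ ι-c a (s ⁎ , T.⁎-∈ s∈T) (1X , T.1X∈) ⟩
        c _ _ _            ≡⟨ cong₂ (c (proj₁ (ι a))) (ι-⁎ a) ι-1X ⟩
        valency (proj₁ (ι a)) ∎

      ι-valency-⁎ : ∀ a → valency (proj₁ a ⁎) ≡ valency (proj₁ (ι a) ⁎)
      ι-valency-⁎ a@(s , s∈T) = trans (ι-valency (s ⁎ , T.⁎-∈ s∈T)) (cong valency (ι-⁎ a))

      -- If the image of `a` lay in H, it would be fixed by `ι`, and injectivity would make it equal
      -- to `a`.
      ι-∉H : ∀ a → proj₁ a ∉ H → proj₁ (ι a) ∉ H
      ι-∉H a a∉H ιa∈H = a∉H (subst (_∈ H) (cong proj₁ (ι-injective (ι-fixes-H (ι a) ιa∈H))) ιa∈H)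

      -- Elements of H are fixed; for the others, preservation of valencies suffices. The next two
      -- lemmas follow the same division.
      ι-c-congʳ : ∀ {r} t (a : El T) → r ∉ T → c r (proj₁ a) t ≡ c r (proj₁ (ι a)) t
      ι-c-congʳ t a r∉T with proj₁ a ∈? H
      ... | yes a∈H = cong (λ b → c _ (proj₁ b) t) (sym (ι-fixes-H a a∈H))
      ... | no  a∉H = c-congʳ t r∉T (proj₂ a) a∉H (proj₂ (ι a)) (ι-∉H a a∉H) (ι-valency-⁎ a)

      ι-c-congˡ : ∀ {s} t (a : El T) → s ∉ T → c (proj₁ a) s t ≡ c (proj₁ (ι a)) s t
      ι-c-congˡ t a s∉T with proj₁ a ∈? H
      ... | yes a∈H = cong (λ b → c (proj₁ b) _ t) (sym (ι-fixes-H a a∈H))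
      ... | no  a∉H = c-congˡ t s∉T (proj₂ a) a∉H (proj₂ (ι a)) (ι-∉H a a∉H) (ι-valency a)

      ι-c-congᵘ : ∀ {s} r (a : El T) → s ∉ T → c r s (proj₁ a) ≡ c r s (proj₁ (ι a))
      ι-c-congᵘ r a s∉T with proj₁ a ∈? H
      ... | yes a∈H = cong (λ b → c r _ (proj₁ b)) (sym (ι-fixes-H a a∈H))
      ... | no  a∉H = c-congᵘ s∉T (proj₂ a) a∉H (proj₂ (ι a)) (ι-∉H a a∉H) (ι-valency a)

      c≡0 : ∀ {r s t} → ¬ (c r s t ≢ 0) → c r s t ≡ 0
      c≡0 = decidable-stable (_ ℕ.≟ 0)

      c-extend : ∀ r s t → c (proj₁ r) (proj₁ s) (proj₁ t)
                         ≡ c (proj₁ (extend T ι r)) (proj₁ (extend T ι s)) (proj₁ (extend T ι t))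
      c-extend (r , _) (s , _) (t , _) with r ∈? T | s ∈? T | t ∈? T
      ... | yes r∈T | yes s∈T | yes t∈T = ι-c (r , r∈T) (s , s∈T) (t , t∈T)
      ... | no  _   | no  _   | no  _   = refl
      ... | no  r∉T | yes s∈T | no  _   = ι-c-congʳ t (s , s∈T) r∉T
      ... | yes r∈T | no  s∉T | no  _   = ι-c-congˡ t (r , r∈T) s∉T
      ... | no  _   | no  s∉T | yes t∈T = ι-c-congᵘ r (t , t∈T) s∉T
      -- From here on exactly two indices lie in T. This remains so after applying the map, since
      -- `ι` keeps T in T, so both intersection numbers vanish.
      ... | yes r∈T | yes s∈T | no  t∉T = trans
        (c≡0 λ ≢0 → t∉T (proj₁ (T.c≢0⇒∈ ≢0) r∈T s∈T))
        (sym (c≡0 λ ≢0 → t∉T (proj₁ (T.c≢0⇒∈ ≢0) (proj₂ (ι (r , r∈T))) (proj₂ (ι (s , s∈T))))))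
      ... | yes r∈T | no  s∉T | yes t∈T = trans
        (c≡0 λ ≢0 → s∉T (proj₁ (proj₂ (T.c≢0⇒∈ ≢0)) r∈T t∈T))
        (sym (c≡0 λ ≢0 → s∉T (proj₁ (proj₂ (T.c≢0⇒∈ ≢0)) (proj₂ (ι (r , r∈T))) (proj₂ (ι (t , t∈T))))))
      ... | no  r∉T | yes s∈T | yes t∈T = trans
        (c≡0 λ ≢0 → r∉T (proj₂ (proj₂ (T.c≢0⇒∈ ≢0)) s∈T t∈T))
        (sym (c≡0 λ ≢0 → r∉T (proj₂ (proj₂ (T.c≢0⇒∈ ≢0)) (proj₂ (ι (s , s∈T))) (proj₂ (ι (t , t∈T))))))

      -- `extend` supplies its own membership proof; uniqueness of such proofs allows any other in
      -- its place.
      extend-∈ : ∀ a (a∈T : proj₁ a ∈ T) → proj₁ (extend T ι a) ≡ proj₁ (ι (proj₁ a , a∈T))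
      extend-∈ (s , _) s∈T with s ∈? T
      ... | yes s∈T′ = cong (λ p → proj₁ (ι (s , p))) ([]=-irrelevant s∈T′ s∈T)
      ... | no  s∉T  = contradiction s∈T s∉T

      extend-∉ : ∀ a → proj₁ a ∉ T → extend T ι a ≡ a
      extend-∉ (s , _) s∉T with s ∈? T
      ... | yes s∈T = contradiction s∈T s∉T
      ... | no  _   = El-≡ refl

      extend-injective : ∀ {a b} → extend T ι a ≡ extend T ι b → a ≡ b
      extend-injective {s , _} {t , _} eq with s ∈? T | t ∈? T
      ... | yes s∈T | yes t∈T = El-≡ (cong proj₁ (ι-injective (El-≡ (cong proj₁ eq))))
      -- In the mixed cases a value of `ι`, which lies in T, would equal an index outside T.
      ... | yes s∈T | no  t∉T = contradiction (subst (_∈ T) (cong proj₁ eq) (proj₂ (ι (s , s∈T)))) t∉T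
      ... | no  s∉T | yes t∈T = contradiction (subst (_∈ T) (sym (cong proj₁ eq)) (proj₂ (ι (t , t∈T)))) s∉T
      ... | no  _   | no  _   = El-≡ (cong proj₁ eq)

      extend-surjective : ∀ b → ∃ λ a → ∀ {a′} → a′ ≡ a → extend T ι a′ ≡ b
      extend-surjective b@(t , _) with t ∈? T
      ... | no  t∉T = b , λ { refl → extend-∉ b t∉T }
      ... | yes t∈T with (s , s∈T) , ι≡ ← proj₂ (proj₁ ι-aut) (t , t∈T) =
        (s , ∈⊤) , λ { refl → El-≡ (trans (extend-∈ (s , ∈⊤) s∈T) (cong proj₁ (ι≡ refl))) }

      extend-isAut : IsAut 𝒮 full (extend T ι)
      extend-isAut = (extend-injective , extend-surjective) , c-extend

theorem1p2 : ∀ {n d : ℕ} (𝒮 : AssociationScheme n d) (H T : Subset d) →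
    Closed 𝒮 H → Closed 𝒮 T → H ⊆ T → StronglyNormal 𝒮 T →
    (∀ (s : Fin d) → s ∉ T → complexProduct 𝒮 ⁅ s ⁆ H ≡ complexProduct 𝒮 ⁅ s ⁆ T) →
    (∀ (t : Fin d) → t ∈ T → t ∉ H → complexProduct 𝒮 ⁅ t ⁆ H ≡ ⁅ t ⁆) →
    ∀ (ι : El T → El T) → IsAut 𝒮 T ι → (∀ (h : El T) → proj₁ h ∈ H → ι h ≡ h) →
    IsAut 𝒮 full (extend T ι)
theorem1p2 𝒮 H T H-closed T-closed H⊆T _ sH≡sT tH≡t ι ι-aut ι-fixes-H =
  Extension.extend-isAut ι ι-aut ι-fixes-H
  where open Scheme.Wreath 𝒮 H-closed T-closed H⊆T sH≡sT tH≡t
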